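{- For all integers $m\ge 1$ and $r,q\geq 2$, $$S_{r^m,q}=\sum_{l=0}^m\sum_{\eta\in\mathcal{C}_l}(-1)^l\binom{m}{l}\binom{l}{\eta_1,\eta_2,\ldots,\eta_p}\zeta(r)^{m-l}\,\zeta(r\eta_1,r\eta_2,\ldots,r\eta_p,q),$$ where $\eta=(\eta_1,\eta_2,\ldots,\eta_p)$ and $p$ is the number of parts of $\eta$.
   Context: Generalized harmonic numbers: $H_n^{(r)}=\sum_{k=1}^n k^{ -r}$ for positive integers $n,r$. Euler sum: $S_{r^m,q}=\sum_{n=1}^{\infty}\frac{(H_n^{(r)})^m}{n^q}$. Multiple zeta values: for positive integers $s_1,\ldots,s_k$ with $s_1>1$, $\zeta(s_1,s_2,\ldots,s_k)=\sum_{n_1>n_2>\cdots>n_k\geq 1}\frac{1}{n_1^{s_1}n_2^{s_2}\cdots n_k^{s_k}}$; for $k=1$ this is the Riemann zeta value. A composition of $l$ is an ordered tuple of positive integers whose elements sum to $l$; $\mathcal{C}_l$ is the set of all compositions of $l$. Multinomial coefficients: $\binom{l}{\eta_1,\eta_2,\ldots,\eta_p}=\frac{l!}{\eta_1!\,\eta_2!\cdots\eta_p!}$. Convention for $l=0$: $\mathcal{C}_0$ consists of the empty composition ($p=0$), the multinomial coefficient is $1$, and the corresponding summand is $\zeta(r)^m\zeta(q)$. -}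

module Defs where

open import Data.Empty using (⊥)
open import Data.Integer.Base using (+_)
import Data.Integer.Base as ℤ
open import Data.List.Base using (List; []; _∷_; [_]; _++_; map; foldr; length)
open import Data.List.Membership.Propositional using (_∈_)
open import Data.List.Membership.Propositional.Properties
  using (∈-map⁺; ∈-map⁻; ∈-++⁺ˡ; ∈-++⁺ʳ; ∈-++⁻)
import Data.List.Properties as List
open import Data.List.Relation.Binary.Disjoint.Propositional using (Disjoint)
open import Data.List.Relation.Unary.All using (All; []; _∷_)
import Data.List.Relation.Unary.All as All
import Data.List.Relation.Unary.All.Properties as All
open import Data.List.Relation.Unary.Any using (here; there)
open import Data.List.Relation.Unary.Unique.Propositional using (Unique; []; _∷_)
import Data.List.Relation.Unary.Unique.Propositional.Properties as Unique
open import Data.Nat.Base using (ℕ; zero; suc; _!; z≤n; s≤s)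
import Data.Nat.Base as ℕ
import Data.Nat.Properties as ℕ
open import Data.Nat.Tactic.RingSolver using (solve-∀)
open import Data.Nat.ListAction using (sum; product)
open import Data.Nat.ListAction.Properties using (product≢0)
open import Data.Product.Base using (∃; _×_; _,_; proj₁; proj₂)
open import Data.Rational.Base hiding (truncate)
open import Data.Rational.Properties
open import Data.Rational.Solver using (module +-*-Solver)
import Data.Rational.Unnormalised.Base as ℚᵘ
import Data.Rational.Unnormalised.Properties as ℚᵘ
open import Data.Sum.Base using (inj₁; inj₂)
open import Relation.Binary.PropositionalEquality
  using (_≡_; refl; sym; trans; cong; cong₂; subst; subst₂; module ≡-Reasoning)
open import Relation.Nullary using (yes; no; contradiction)

open import Algebra.Definitions.RawSemiring +-*-rawSemiring public
  using () renaming (_^_ to _^ℚ_)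

open +-*-Solver using (solve; _:=_; _:+_; _:*_; _:-_; :-_; con)

private

  0≤1 : 0ℚ ≤ 1ℚ
  0≤1 = nonNegative⁻¹ 1ℚ

  0≤+ : ∀ {p q} → 0ℚ ≤ p → 0ℚ ≤ q → 0ℚ ≤ p + q
  0≤+ {p} {q} 0≤p 0≤q = +-mono-≤ {0ℚ} {p} {0ℚ} {q} 0≤p 0≤q

  *-monoˡ : ∀ {r p q} → 0ℚ ≤ r → p ≤ q → r * p ≤ r * q
  *-monoˡ {r} 0≤r = *-monoˡ-≤-nonNeg r {{nonNegative 0≤r}}

  *-monoʳ : ∀ {r p q} → 0ℚ ≤ r → p ≤ q → p * r ≤ q * r
  *-monoʳ {r} 0≤r = *-monoʳ-≤-nonNeg r {{nonNegative 0≤r}}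

  *-mono : ∀ {p q r s} → 0ℚ ≤ q → 0ℚ ≤ r → p ≤ q → r ≤ s → p * r ≤ q * s
  *-mono 0≤q 0≤r p≤q r≤s = ≤-trans (*-monoʳ 0≤r p≤q) (*-monoˡ 0≤q r≤s)

  0≤* : ∀ {p q} → 0ℚ ≤ p → 0ℚ ≤ q → 0ℚ ≤ p * q
  0≤* {p} {q} 0≤p 0≤q = subst (_≤ p * q) (*-zeroʳ p) (*-monoˡ 0≤p 0≤q)

  0<* : ∀ {p q} → 0ℚ < p → 0ℚ < q → 0ℚ < p * q
  0<* {p} {q} 0<p 0<q =
    subst (_< p * q) (*-zeroʳ p) (*-monoʳ-<-pos p {{positive 0<p}} 0<q)

  p≤p+q : ∀ {p q} → 0ℚ ≤ q → p ≤ p + q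
  p≤p+q {p} {q} 0≤q = subst (_≤ p + q) (+-identityʳ p) (+-monoʳ-≤ p 0≤q)

  *≤ : ∀ {p q} → 0ℚ ≤ p → q ≤ 1ℚ → p * q ≤ p
  *≤ {p} {q} 0≤p q≤1 = subst (p * q ≤_) (*-identityʳ p) (*-monoˡ 0≤p q≤1)

  ≤-from-diff : ∀ {p q} d → 0ℚ ≤ d → q ≡ p + d → p ≤ q
  ≤-from-diff d 0≤d refl = p≤p+q 0≤d

  diff≥0 : ∀ {p q} → p ≤ q → 0ℚ ≤ q - p
  diff≥0 {p} {q} p≤q = subst (_≤ q - p) (+-inverseʳ p) (+-monoˡ-≤ (- p) p≤q)

  diff≤ : ∀ {p q r} → p ≤ r + q → p - q ≤ r
  diff≤ {p} {q} {r} h =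
    subst (p - q ≤_)
      (solve 2 (λ r q → (r :+ q) :- q := r) refl r q)
      (+-monoˡ-≤ (- q) h)

  ∣∣< : ∀ {p ε} → p < ε → - p < ε → ∣ p ∣ < ε
  ∣∣< {p} {ε} h₁ h₂ with ∣p∣≡p∨∣p∣≡-p p
  ... | inj₁ eq = subst (_< ε) (sym eq) h₁
  ... | inj₂ eq = subst (_< ε) (sym eq) h₂

  neg-diff : ∀ p q → - (p - q) ≡ q - p
  neg-diff = solve 2 (λ p q → :- (p :- q) := q :- p) refl

-- A real number is a Cauchy sequence of rationals; the arithmetic operations act
-- termwise, and two reals are equal (≃ℝ) when their difference tends to 0.

Cauchy : (ℕ → ℚ) → Set
Cauchy x = ∀ ε → 0ℚ < ε →
  ∃ λ N → ∀ m n → N ℕ.≤ m → N ℕ.≤ n → ∣ x m - x n ∣ < ε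

record ℝ : Set where
  constructor mkℝ
  field
    seq    : ℕ → ℚ
    cauchy : Cauchy seq

open ℝ public

infix 4 _≃ℝ_

_≃ℝ_ : ℝ → ℝ → Set
x ≃ℝ y = ∀ ε → 0ℚ < ε →
  ∃ λ N → ∀ n → N ℕ.≤ n → ∣ seq x n - seq y n ∣ < ε

private

  const-cauchy : ∀ p → Cauchy (λ _ → p)
  const-cauchy p ε 0<ε =
    0 , λ _ _ _ _ → subst (_< ε) (sym (cong ∣_∣ (+-inverseʳ p))) 0<ε

  ½ε : ∀ {ε} → 0ℚ < ε → 0ℚ < ½ * ε
  ½ε 0<ε = 0<* (positive⁻¹ ½) 0<ε

  ½ε+½ε : ∀ ε → ½ * ε + ½ * ε ≡ ε
  ½ε+½ε = solve 1 (λ ε → con ½ :* ε :+ con ½ :* ε := ε) refl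

  +-cauchy : ∀ {x y} → Cauchy x → Cauchy y → Cauchy (λ n → x n + y n)
  +-cauchy {x} {y} cx cy ε 0<ε
    with cx (½ * ε) (½ε 0<ε) | cy (½ * ε) (½ε 0<ε)
  ... | M , hM | N , hN = M ℕ.⊔ N , λ m n m≥ n≥ → begin-strict
    ∣ (x m + y m) - (x n + y n) ∣    ≡⟨ cong ∣_∣ (regroup (x m) (y m) (x n) (y n)) ⟩
    ∣ (x m - x n) + (y m - y n) ∣    ≤⟨ ∣p+q∣≤∣p∣+∣q∣ (x m - x n) (y m - y n) ⟩
    ∣ x m - x n ∣ + ∣ y m - y n ∣    <⟨ +-mono-<
      (hM m n (ℕ.m⊔n≤o⇒m≤o M N m≥) (ℕ.m⊔n≤o⇒m≤o M N n≥))
      (hN m n (ℕ.m⊔n≤o⇒n≤o M N m≥) (ℕ.m⊔n≤o⇒n≤o M N n≥)) ⟩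
    ½ * ε + ½ * ε                    ≡⟨ ½ε+½ε ε ⟩
    ε                                ∎
    where
    open ≤-Reasoning
    regroup : ∀ a b c d → (a + b) - (c + d) ≡ (a - c) + (b - d)
    regroup = solve 4 (λ a b c d → (a :+ b) :- (c :+ d) := (a :- c) :+ (b :- d)) refl

  neg-cauchy : ∀ {x} → Cauchy x → Cauchy (λ n → - x n)
  neg-cauchy {x} cx ε 0<ε with cx ε 0<ε
  ... | N , hN = N , λ m n m≥ n≥ → subst (_< ε)
    (trans (sym (∣-p∣≡∣p∣ (x m - x n))) (cong ∣_∣ (neg-distrib-+ (x m) (- x n))))
    (hN m n m≥ n≥)

  Bounded : (ℕ → ℚ) → Set
  Bounded x = ∃ λ B → 0ℚ < B × ∃ λ N → ∀ n → N ℕ.≤ n → ∣ x n ∣ ≤ B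

  bounded : ∀ {x} → Cauchy x → Bounded x
  bounded {x} cx with cx 1ℚ (positive⁻¹ 1ℚ)
  ... | N , hN = 1ℚ + ∣ x N ∣ , 0<B , N , λ n n≥ → begin
    ∣ x n ∣                  ≡⟨ cong ∣_∣ (split (x n) (x N)) ⟩
    ∣ (x n - x N) + x N ∣    ≤⟨ ∣p+q∣≤∣p∣+∣q∣ (x n - x N) (x N) ⟩
    ∣ x n - x N ∣ + ∣ x N ∣  ≤⟨ +-monoˡ-≤ ∣ x N ∣ (<⇒≤ (hN n N n≥ ℕ.≤-refl)) ⟩
    1ℚ + ∣ x N ∣             ∎
    where
    open ≤-Reasoning
    0<B : 0ℚ < 1ℚ + ∣ x N ∣
    0<B = <-≤-trans (positive⁻¹ 1ℚ) (p≤p+q (0≤∣p∣ (x N)))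
    split : ∀ a b → a ≡ (a - b) + b
    split = solve 2 (λ a b → a := (a :- b) :+ b) refl

  Quotient : ℚ → ℚ → Set
  Quotient B ε = ∃ λ δ → 0ℚ < δ × B * δ ≡ ε

  quot : ∀ {B ε} → 0ℚ < B → 0ℚ < ε → Quotient B ε
  quot {B} {ε} 0<B 0<ε = 1/B * ε , 0<* (positive⁻¹ 1/B {{1/pos⇒pos B}}) 0<ε ,
    trans (sym (*-assoc B 1/B ε))
      (trans (cong (_* ε) (*-inverseʳ B)) (*-identityˡ ε))
    where
    instance
      B>0 : Positive B
      B>0 = positive 0<B
      B≢0 : NonZero B
      B≢0 = pos⇒nonZero B
    1/B : ℚ
    1/B = 1/ B

  *-diff : ∀ a b c d → a * b - c * d ≡ a * (b - d) + d * (a - c)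
  *-diff = solve 4
    (λ a b c d → a :* b :- c :* d := a :* (b :- d) :+ d :* (a :- c)) refl

  ∣*∣< : ∀ p q {B β} → 0ℚ < B → ∣ p ∣ ≤ B → ∣ q ∣ < β → ∣ p * q ∣ < B * β
  ∣*∣< p q {B} {β} 0<B p≤B q<β = begin-strict
    ∣ p * q ∣      ≡⟨ ∣p*q∣≡∣p∣*∣q∣ p q ⟩
    ∣ p ∣ * ∣ q ∣  ≤⟨ *-monoʳ (0≤∣p∣ q) p≤B ⟩
    B * ∣ q ∣      <⟨ *-monoʳ-<-pos B {{positive 0<B}} q<β ⟩
    B * β          ∎
    where open ≤-Reasoning

  *-cauchy : ∀ {x y} → Cauchy x → Cauchy y → Cauchy (λ n → x n * y n)
  *-cauchy {x} {y} cx cy ε 0<ε = R , bound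
    where
    bx : Bounded x
    bx = bounded cx
    by : Bounded y
    by = bounded cy
    B C : ℚ
    B = bx .proj₁
    C = by .proj₁
    0<B : 0ℚ < B
    0<B = bx .proj₂ .proj₁
    0<C : 0ℚ < C
    0<C = by .proj₂ .proj₁
    qB : Quotient B (½ * ε)
    qB = quot 0<B (½ε 0<ε)
    qC : Quotient C (½ * ε)
    qC = quot 0<C (½ε 0<ε)
    β γ : ℚ
    β = qB .proj₁
    γ = qC .proj₁
    K L M N R : ℕ
    K = bx .proj₂ .proj₂ .proj₁
    L = by .proj₂ .proj₂ .proj₁
    M = cx γ (qC .proj₂ .proj₁) .proj₁
    N = cy β (qB .proj₂ .proj₁) .proj₁
    R = (K ℕ.⊔ L) ℕ.⊔ (M ℕ.⊔ N)
    K≤R : K ℕ.≤ R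
    K≤R = ℕ.≤-trans (ℕ.m≤m⊔n K L) (ℕ.m≤m⊔n (K ℕ.⊔ L) (M ℕ.⊔ N))
    L≤R : L ℕ.≤ R
    L≤R = ℕ.≤-trans (ℕ.m≤n⊔m K L) (ℕ.m≤m⊔n (K ℕ.⊔ L) (M ℕ.⊔ N))
    M≤R : M ℕ.≤ R
    M≤R = ℕ.≤-trans (ℕ.m≤m⊔n M N) (ℕ.m≤n⊔m (K ℕ.⊔ L) (M ℕ.⊔ N))
    N≤R : N ℕ.≤ R
    N≤R = ℕ.≤-trans (ℕ.m≤n⊔m M N) (ℕ.m≤n⊔m (K ℕ.⊔ L) (M ℕ.⊔ N))
    open ≤-Reasoning
    bound : ∀ m n → R ℕ.≤ m → R ℕ.≤ n → ∣ x m * y m - x n * y n ∣ < ε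
    bound m n m≥ n≥ = begin-strict
      ∣ x m * y m - x n * y n ∣
        ≡⟨ cong ∣_∣ (*-diff (x m) (y m) (x n) (y n)) ⟩
      ∣ x m * (y m - y n) + y n * (x m - x n) ∣
        ≤⟨ ∣p+q∣≤∣p∣+∣q∣ (x m * (y m - y n)) (y n * (x m - x n)) ⟩
      ∣ x m * (y m - y n) ∣ + ∣ y n * (x m - x n) ∣
        <⟨ +-mono-<
             (∣*∣< (x m) (y m - y n) 0<B
               (bx .proj₂ .proj₂ .proj₂ m (ℕ.≤-trans K≤R m≥))
               (cy β (qB .proj₂ .proj₁) .proj₂ m n (ℕ.≤-trans N≤R m≥) (ℕ.≤-trans N≤R n≥)))
             (∣*∣< (y n) (x m - x n) 0<C
               (by .proj₂ .proj₂ .proj₂ n (ℕ.≤-trans L≤R n≥))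
               (cx γ (qC .proj₂ .proj₁) .proj₂ m n (ℕ.≤-trans M≤R m≥) (ℕ.≤-trans M≤R n≥))) ⟩
      B * β + C * γ
        ≡⟨ cong₂ _+_ (qB .proj₂ .proj₂) (qC .proj₂ .proj₂) ⟩
      ½ * ε + ½ * ε
        ≡⟨ ½ε+½ε ε ⟩
      ε ∎

infix  8 -ℝ_
infixl 7 _*ℝ_
infixl 6 _+ℝ_
infixr 8 _^ℝ_

fromℚ : ℚ → ℝ
fromℚ p = mkℝ (λ _ → p) (const-cauchy p)

0ℝ 1ℝ : ℝ
0ℝ = fromℚ 0ℚ
1ℝ = fromℚ 1ℚ

fromℕ : ℕ → ℝ
fromℕ n = fromℚ (+ n / 1)

_+ℝ_ : ℝ → ℝ → ℝ
x +ℝ y = mkℝ (λ n → seq x n + seq y n) (+-cauchy {seq x} {seq y} (cauchy x) (cauchy y))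

-ℝ_ : ℝ → ℝ
-ℝ x = mkℝ (λ n → - seq x n) (neg-cauchy {seq x} (cauchy x))

_*ℝ_ : ℝ → ℝ → ℝ
x *ℝ y = mkℝ (λ n → seq x n * seq y n) (*-cauchy {seq x} {seq y} (cauchy x) (cauchy y))

_^ℝ_ : ℝ → ℕ → ℝ
x ^ℝ zero  = 1ℝ
x ^ℝ suc n = x *ℝ x ^ℝ n

∑ : ∀ {a} {A : Set a} → List A → (A → ℝ) → ℝ
∑ xs f = foldr _+ℝ_ 0ℝ (map f xs)

infix 5 ∑
syntax ∑ xs (λ x → e) = ∑[ x ∈ xs ] e

record Composition (l : ℕ) : Set where
  constructor composition
  field
    parts   : List ℕ
    parts>0 : All (0 ℕ.<_) parts
    sums    : sum parts ≡ l

open Composition public using (parts)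

module _ where
  open Composition

  cons : ∀ k {l} → Composition l → Composition (suc k ℕ.+ l)
  cons k η = composition (suc k ∷ parts η) (s≤s z≤n ∷ parts>0 η)
                         (cong (suc k ℕ.+_) (sums η))

  recast : ∀ {l l′} → l ≡ l′ → Composition l → Composition l′
  recast eq η = composition (parts η) (parts>0 η) (trans (sums η) eq)

-- All compositions of k + 1 + l whose first part is at least k + 1.
compositionsFrom : ∀ k l → List (Composition (suc k ℕ.+ l))
compositionsFrom k zero    = [ cons k (composition [] [] refl) ]
compositionsFrom k (suc l) =
  map (cons k) (compositionsFrom 0 l) ++
  map (recast (sym (ℕ.+-suc (suc k) l))) (compositionsFrom (suc k) l)

compositions : ∀ l → List (Composition l)
compositions zero    = [ composition [] [] refl ]
compositions (suc l) = compositionsFrom 0 l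

-- `compositions l` lists every composition of l, each exactly once.
abstract

  private
    unfold : ∀ k l → map parts (compositionsFrom k (suc l)) ≡
             map (suc k ∷_) (map parts (compositionsFrom 0 l)) ++
             map parts (compositionsFrom (suc k) l)
    unfold k l = trans
      (List.map-++ parts (map (cons k) (compositionsFrom 0 l)) _)
      (cong₂ _++_
        (trans (sym (List.map-∘ (compositionsFrom 0 l)))
               (List.map-∘ (compositionsFrom 0 l)))
        (sym (List.map-∘ (compositionsFrom (suc k) l))))

    complete-from : ∀ k l j ηs → All (0 ℕ.<_) ηs → k ℕ.≤ j →
      suc j ℕ.+ sum ηs ≡ suc k ℕ.+ l →
      (suc j ∷ ηs) ∈ map parts (compositionsFrom k l)
    complete-from k zero j [] pos k≤j eq
      rewrite ℕ.+-identityʳ j | ℕ.+-identityʳ k | ℕ.suc-injective eq = here refl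
    complete-from k zero j (suc e ∷ ηs) pos k≤j eq =
      contradiction (trans eq (ℕ.+-identityʳ (suc k)))
        (λ eq′ → ℕ.<-irrefl (sym eq′)
          (ℕ.≤-<-trans (s≤s k≤j) (ℕ.m<m+n (suc j) (s≤s z≤n))))
    complete-from k zero j (zero ∷ ηs) (() ∷ pos) k≤j eq
    complete-from k (suc l) j ηs pos k≤j eq
      rewrite unfold k l with k ℕ.≟ j
    ... | no k≢j = ∈-++⁺ʳ (map (suc k ∷_) (map parts (compositionsFrom 0 l)))
      (complete-from (suc k) l j ηs pos (ℕ.≤∧≢⇒< k≤j k≢j)
        (trans eq (ℕ.+-suc (suc k) l)))
    complete-from k (suc l) .k [] pos k≤j eq | yes refl =
      contradiction (ℕ.+-cancelˡ-≡ (suc k) _ _ eq) (λ ())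
    complete-from k (suc l) .k (zero ∷ ηs) (() ∷ pos) k≤j eq | yes refl
    complete-from k (suc l) .k (suc e ∷ ηs) (_ ∷ pos) k≤j eq | yes refl =
      ∈-++⁺ˡ (∈-map⁺ (suc k ∷_)
        (complete-from 0 l e ηs pos z≤n (ℕ.+-cancelˡ-≡ (suc k) _ _ eq)))

    head≥ : ∀ k l {ηs} → ηs ∈ map parts (compositionsFrom k l) →
            ∃ λ j → ∃ λ ηs′ → ηs ≡ suc j ∷ ηs′ × k ℕ.≤ j
    head≥ k zero (here refl) = k , [] , refl , ℕ.≤-refl
    head≥ k (suc l) h rewrite unfold k l
      with ∈-++⁻ (map (suc k ∷_) (map parts (compositionsFrom 0 l))) h
    ... | inj₁ h₁ with ∈-map⁻ (suc k ∷_) h₁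
    ...   | ηs′ , _ , eq = k , ηs′ , eq , ℕ.≤-refl
    head≥ k (suc l) h | inj₂ h₂ with head≥ (suc k) l h₂
    ...   | j , ηs′ , eq , k<j = j , ηs′ , eq , ℕ.<⇒≤ k<j

    unique-from : ∀ k l → Unique (map parts (compositionsFrom k l))
    unique-from k zero    = [] ∷ []
    unique-from k (suc l) rewrite unfold k l =
      Unique.++⁺ (Unique.map⁺ List.∷-injectiveʳ (unique-from 0 l))
                 (unique-from (suc k) l) disjoint
      where
      disjoint : Disjoint (map (suc k ∷_) (map parts (compositionsFrom 0 l)))
                          (map parts (compositionsFrom (suc k) l))
      disjoint (h₁ , h₂) with ∈-map⁻ (suc k ∷_) h₁ | head≥ (suc k) l h₂
      ... | _ , _ , refl | _ , _ , refl , k<k = ℕ.<-irrefl refl k<k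

  compositions-complete : ∀ {l} (η : Composition l) →
                          parts η ∈ map parts (compositions l)
  compositions-complete {zero}  (composition []           pos       eq) = here refl
  compositions-complete {zero}  (composition (zero ∷ ηs)  (() ∷ _)  eq)
  compositions-complete {suc l} (composition (zero ∷ ηs)  (() ∷ _)  eq)
  compositions-complete {suc l} (composition (suc j ∷ ηs) (_ ∷ pos) eq) =
    complete-from 0 l j ηs pos z≤n eq

  compositions-unique : ∀ l → Unique (map parts (compositions l))
  compositions-unique zero    = [] ∷ []
  compositions-unique (suc l) = unique-from 0 l

multinomial : ℕ → List ℕ → ℚ
multinomial l ηs = (+ (l !) / product (map _! ηs))
  {{product≢0 (All.map⁺ (All.universal ℕ._!≢0 ηs))}}

-- In all sums below, the index i < N stands for the integer n = i + 1 ≤ N.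

∑< : ℕ → (ℕ → ℚ) → ℚ
∑< zero    f = 0ℚ
∑< (suc N) f = ∑< N f + f N

infix 5 ∑<
syntax ∑< N (λ i → e) = ∑[ i < N ] e

recip : ℕ → ℚ
recip i = + 1 / suc i

H : ℕ → ℕ → ℚ
H r n = ∑[ i < n ] recip i ^ℚ r

-- The sum of 1 / (n₁^s₁ ⋯ nₖ^sₖ) over N ≥ n₁ > ⋯ > nₖ ≥ 1: for n₁ = i + 1 the
-- remaining indices range over i ≥ n₂ > ⋯ > nₖ ≥ 1.
ζ≤ : ℕ → List ℕ → ℚ
ζ≤ N []       = 1ℚ
ζ≤ N (s ∷ ss) = ∑[ i < N ] (recip i ^ℚ s * ζ≤ i ss)

-- The sum of (H_n^(r))^m / n^q over N ≥ n ≥ 1.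
S≤ : ℕ → (r m q : ℕ) → ℚ
S≤ N r m q = ∑[ i < N ] (H r (suc i) ^ℚ m * recip i ^ℚ q)

Admissible : List ℕ → Set
Admissible []       = ⊥
Admissible (s ∷ ss) = 1 ℕ.< s × All (0 ℕ.<_) ss

private

  recip-step : ∀ i → recip i ≡ recip (suc i) + recip i * recip (suc i)
  recip-step i = toℚᵘ-injective (begin
    toℚᵘ x                           ≈⟨ toℚᵘ-fromℚᵘ u ⟩
    u                                ≈⟨ ℚᵘ.*≡* (cong +_ (cross i)) ⟩
    v ℚᵘ.+ u ℚᵘ.* v                  ≈⟨ ℚᵘ.+-cong (toℚᵘ-fromℚᵘ v)
                                          (ℚᵘ.*-cong (toℚᵘ-fromℚᵘ u) (toℚᵘ-fromℚᵘ v)) ⟨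
    toℚᵘ y ℚᵘ.+ toℚᵘ x ℚᵘ.* toℚᵘ y   ≈⟨ ℚᵘ.+-congʳ (toℚᵘ y) (toℚᵘ-homo-* x y) ⟨
    toℚᵘ y ℚᵘ.+ toℚᵘ (x * y)         ≈⟨ toℚᵘ-homo-+ y (x * y) ⟨
    toℚᵘ (y + x * y)                 ∎)
    where
    open ℚᵘ.≃-Reasoning
    x = recip i
    y = recip (suc i)
    u = ℚᵘ.mkℚᵘ (+ 1) i
    v = ℚᵘ.mkℚᵘ (+ 1) (suc i)
    cross : ∀ i →
      1 ℕ.* ((2 ℕ.+ i) ℕ.* ((1 ℕ.+ i) ℕ.* (2 ℕ.+ i))) ≡
      (1 ℕ.* ((1 ℕ.+ i) ℕ.* (2 ℕ.+ i)) ℕ.+ 1 ℕ.* (2 ℕ.+ i)) ℕ.* (1 ℕ.+ i)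
    cross = solve-∀

  recip>0 : ∀ i → 0ℚ < recip i
  recip>0 i = positive⁻¹ (recip i) {{normalize-pos 1 (suc i)}}

  recip≥0 : ∀ i → 0ℚ ≤ recip i
  recip≥0 i = <⇒≤ (recip>0 i)

  recip-anti : ∀ i → recip (suc i) ≤ recip i
  recip-anti i = ≤-from-diff (recip i * recip (suc i))
    (0≤* (recip≥0 i) (recip≥0 (suc i))) (recip-step i)

  recip≤1 : ∀ i → recip i ≤ 1ℚ
  recip≤1 zero    = ≤-refl
  recip≤1 (suc i) = ≤-trans (recip-anti i) (recip≤1 i)

  recip≤2recip : ∀ i → recip i ≤ recip (suc i) + recip (suc i)
  recip≤2recip i = subst₂ _≤_ (sym (recip-step i))
    (cong (λ z → recip (suc i) + z) (*-identityˡ (recip (suc i))))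
    (+-monoʳ-≤ (recip (suc i)) (*-monoʳ (recip≥0 (suc i)) (recip≤1 i)))

  archimedean : ∀ {C δ} → 0ℚ < C → 0ℚ < δ → ∃ λ i → C * recip i < δ
  archimedean {C} 0<C 0<δ with quot 0<C 0<δ
  ... | δ′ , 0<δ′ , Cδ′≡δ with below δ′ 0<δ′
    where
    below : ∀ δ → 0ℚ < δ → ∃ λ i → recip i < δ
    below (mkℚ (+ suc n) d _) _ = suc d , toℚᵘ-cancel-<
      (ℚᵘ.<-respˡ-≃ (ℚᵘ.≃-sym (toℚᵘ-fromℚᵘ (ℚᵘ.mkℚᵘ (+ 1) (suc d))))
        (ℚᵘ.*<* (ℤ.+<+ (ℕ.<-≤-trans {1 ℕ.* suc d} {suc (suc d)} {suc n ℕ.* suc (suc d)}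
          (s≤s (ℕ.≤-reflexive (ℕ.*-identityˡ (suc d))))
          (ℕ.m≤n*m (suc (suc d)) (suc n))))))
    below (mkℚ (+ zero) d _) (*<* (ℤ.+<+ ()))
    below (mkℚ ℤ.-[1+ n ] d _) (*<* ())
  ... | i , h = i , subst (C * recip i <_) Cδ′≡δ (*-monoʳ-<-pos C {{positive 0<C}} h)

  ι : ℕ → ℚ
  ι zero    = 0ℚ
  ι (suc n) = ι n + 1ℚ

  ι≥0 : ∀ n → 0ℚ ≤ ι n
  ι≥0 zero    = ≤-refl
  ι≥0 (suc n) = 0≤+ (ι≥0 n) 0≤1

  recip*ι : ∀ n → recip n * ι (suc n) ≡ 1ℚ
  recip*ι zero    = refl
  recip*ι (suc n) = begin
    y * (j + 1ℚ)                ≡⟨ regroup x y j ⟩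
    (y + x * y) * j + y * (1ℚ - x * j)
      ≡⟨ cong₂ _+_ (cong (_* j) (sym (recip-step n)))
           (cong (λ z → y * (1ℚ - z)) (recip*ι n)) ⟩
    x * j + y * 0ℚ              ≡⟨ cong₂ _+_ (recip*ι n) (*-zeroʳ y) ⟩
    1ℚ                          ∎
    where
    open ≡-Reasoning
    x = recip n
    y = recip (suc n)
    j = ι (suc n)
    regroup : ∀ x y j → y * (j + 1ℚ) ≡ (y + x * y) * j + y * (1ℚ - x * j)
    regroup = solve 3 (λ x y j → y :* (j :+ con 1ℚ) :=
      (y :+ x :* y) :* j :+ y :* (con 1ℚ :- x :* j)) refl

  ^≥0 : ∀ {p} n → 0ℚ ≤ p → 0ℚ ≤ p ^ℚ n
  ^≥0 zero    0≤p = 0≤1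
  ^≥0 (suc n) 0≤p = 0≤* 0≤p (^≥0 n 0≤p)

  ^≤1 : ∀ {p} n → 0ℚ ≤ p → p ≤ 1ℚ → p ^ℚ n ≤ 1ℚ
  ^≤1 zero    0≤p p≤1 = ≤-refl
  ^≤1 (suc n) 0≤p p≤1 = ≤-trans (*≤ 0≤p (^≤1 n 0≤p p≤1)) p≤1

  ^-mono : ∀ {p q} n → 0ℚ ≤ p → p ≤ q → p ^ℚ n ≤ q ^ℚ n
  ^-mono zero    0≤p p≤q = ≤-refl
  ^-mono (suc n) 0≤p p≤q =
    *-mono (≤-trans 0≤p p≤q) (^≥0 n 0≤p) p≤q (^-mono n 0≤p p≤q)

  recip^≤recip : ∀ i {s} → 0 ℕ.< s → recip i ^ℚ s ≤ recip i
  recip^≤recip i {suc s} _ = *≤ (recip≥0 i) (^≤1 s (recip≥0 i) (recip≤1 i))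

  recip^≤recip² : ∀ i {s} → 1 ℕ.< s → recip i ^ℚ s ≤ recip i * recip i
  recip^≤recip² i {suc (suc s)} _ = *-monoˡ (recip≥0 i) (recip^≤recip i {suc s} (s≤s z≤n))
  recip^≤recip² i {suc zero} (s≤s ())

  -- (h + x)^(k+1) − h^(k+1) ≤ (k + 1) x (h + x)^k
  ^-step : ∀ {h x} k → 0ℚ ≤ h → 0ℚ ≤ x →
    (h + x) ^ℚ suc k ≤ h ^ℚ suc k + ι (suc k) * (x * (h + x) ^ℚ k)
  ^-step {h} {x} zero 0≤h 0≤x = ≤-reflexive (base h x)
    where
    base : ∀ h x → (h + x) * 1ℚ ≡ h * 1ℚ + (0ℚ + 1ℚ) * (x * 1ℚ)
    base = solve 2 (λ h x → (h :+ x) :* con 1ℚ :=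
      h :* con 1ℚ :+ (con 0ℚ :+ con 1ℚ) :* (x :* con 1ℚ)) refl
  ^-step {h} {x} (suc k) 0≤h 0≤x = begin
    (h + x) * (g * P)                        ≡⟨ eq₁ h x (g * P) ⟩
    h * (g * P) + x * (g * P)                ≤⟨ +-monoˡ-≤ (x * (g * P)) (*-monoˡ 0≤h (^-step k 0≤h 0≤x)) ⟩
    h * (Q + j * (x * P)) + x * (g * P)      ≤⟨ ≤-from-diff (x * (j * (x * P)))
      (0≤* 0≤x (0≤* (ι≥0 (suc k)) (0≤* 0≤x (^≥0 k (0≤+ 0≤h 0≤x))))) (eq₂ h x P Q j) ⟩
    h * Q + (j + 1ℚ) * (x * (g * P))         ∎
    where
    open ≤-Reasoning
    g = h + x
    P = g ^ℚ k
    Q = h ^ℚ suc k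
    j = ι (suc k)
    eq₁ : ∀ h x R → (h + x) * R ≡ h * R + x * R
    eq₁ = solve 3 (λ h x R → (h :+ x) :* R := h :* R :+ x :* R) refl
    eq₂ : ∀ h x P Q j → h * Q + (j + 1ℚ) * (x * ((h + x) * P)) ≡
          (h * (Q + j * (x * P)) + x * ((h + x) * P)) + x * (j * (x * P))
    eq₂ = solve 5 (λ h x P Q j → h :* Q :+ (j :+ con 1ℚ) :* (x :* ((h :+ x) :* P)) :=
          (h :* (Q :+ j :* (x :* P)) :+ x :* ((h :+ x) :* P)) :+ x :* (j :* (x :* P))) refl

  -- H_n^k grows at most like a(n) = ∏_{j ≤ n} (1 + 1/(4j)), and a(n)² ≤ n + 1.

  h : ℕ → ℚ
  h n = ∑[ i < n ] recip i

  h≥0 : ∀ n → 0ℚ ≤ h n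
  h≥0 zero    = ≤-refl
  h≥0 (suc n) = 0≤+ (h≥0 n) (recip≥0 n)

  ¼ : ℚ
  ¼ = + 1 / 4

  0≤¼ : 0ℚ ≤ ¼
  0≤¼ = nonNegative⁻¹ ¼

  a : ℕ → ℚ
  a zero    = 1ℚ
  a (suc n) = a n + ¼ * (recip n * a n)

  a≥1 : ∀ n → 1ℚ ≤ a n
  a≥1 zero    = ≤-refl
  a≥1 (suc n) = ≤-trans (a≥1 n)
    (p≤p+q (0≤* 0≤¼ (0≤* (recip≥0 n) (≤-trans 0≤1 (a≥1 n)))))

  a≥0 : ∀ n → 0ℚ ≤ a n
  a≥0 n = ≤-trans 0≤1 (a≥1 n)

  a²≤ : ∀ n → a n * a n ≤ ι (suc n)
  a²≤ zero    = ≤-refl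
  a²≤ (suc n) = ≤-from-diff
    ((j - A * A) * (1ℚ + x) + A * A * (x * (c + d * (1ℚ - x))))
    (0≤+ (0≤* (diff≥0 (a²≤ n)) (0≤+ 0≤1 (recip≥0 n)))
         (0≤* (0≤* (a≥0 n) (a≥0 n))
              (0≤* (recip≥0 n) (0≤+ (nonNegative⁻¹ c)
                (0≤* (nonNegative⁻¹ d) (diff≥0 (recip≤1 n)))))))
    (trans (cong (λ z → j + z) (sym (recip*ι n))) (eq A x j))
    where
    A = a n
    x = recip n
    j = ι (suc n)
    c = + 7 / 16
    d = + 1 / 16
    eq : ∀ A x j → j + x * j ≡
      (A + ¼ * (x * A)) * (A + ¼ * (x * A)) +
      ((j - A * A) * (1ℚ + x) + A * A * (x * (c + d * (1ℚ - x))))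
    eq = solve 3 (λ A x j → j :+ x :* j :=
      (A :+ con ¼ :* (x :* A)) :* (A :+ con ¼ :* (x :* A)) :+
      ((j :- A :* A) :* (con 1ℚ :+ x) :+
        A :* A :* (x :* (con c :+ con d :* (con 1ℚ :- x))))) refl

  five : ℚ
  five = + 5 / 1

  κ : ℕ → ℚ
  κ zero    = 1ℚ
  κ (suc k) = five * (ι (suc k) * κ k)

  κ>0 : ∀ k → 0ℚ < κ k
  κ>0 zero    = positive⁻¹ 1ℚ
  κ>0 (suc k) = 0<* (positive⁻¹ five)
    (0<* (<-≤-trans (positive⁻¹ 1ℚ) (subst (1ℚ ≤_) (+-comm 1ℚ (ι k)) (p≤p+q (ι≥0 k)))) (κ>0 k))

  κ≥0 : ∀ k → 0ℚ ≤ κ k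
  κ≥0 k = <⇒≤ (κ>0 k)

  h^≤ : ∀ k n → h n ^ℚ k ≤ κ k * a n
  h^≤ zero    n       = subst (1ℚ ≤_) (sym (*-identityˡ (a n))) (a≥1 n)
  h^≤ (suc k) zero    = subst (_≤ κ (suc k) * 1ℚ) (sym (*-zeroˡ (0ℚ ^ℚ k)))
    (0≤* (κ≥0 (suc k)) 0≤1)
  h^≤ (suc k) (suc n) = begin
    (h n + x) ^ℚ suc k
      ≤⟨ ^-step k (h≥0 n) (recip≥0 n) ⟩
    h n ^ℚ suc k + L * (x * (h n + x) ^ℚ k)
      ≤⟨ +-mono-≤ (h^≤ (suc k) n)
           (*-monoˡ (ι≥0 (suc k)) (*-monoˡ (recip≥0 n) (h^≤ k (suc n)))) ⟩
    five * (L * K) * A + L * (x * (K * (A + ¼ * (x * A))))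
      ≤⟨ ≤-from-diff (L * K * (x * A) * (¼ * (1ℚ - x)))
           (0≤* (0≤* (0≤* (ι≥0 (suc k)) (κ≥0 k)) (0≤* (recip≥0 n) (a≥0 n)))
                (0≤* 0≤¼ (diff≥0 (recip≤1 n))))
           (eq L K A x) ⟩
    five * (L * K) * (A + ¼ * (x * A)) ∎
    where
    open ≤-Reasoning
    x = recip n
    A = a n
    L = ι (suc k)
    K = κ k
    eq : ∀ L K A x → five * (L * K) * (A + ¼ * (x * A)) ≡
      (five * (L * K) * A + L * (x * (K * (A + ¼ * (x * A))))) +
      L * K * (x * A) * (¼ * (1ℚ - x))
    eq = solve 4 (λ L K A x → con five :* (L :* K) :* (A :+ con ¼ :* (x :* A)) :=
      (con five :* (L :* K) :* A :+ L :* (x :* (K :* (A :+ con ¼ :* (x :* A))))) :+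
      L :* K :* (x :* A) :* (con ¼ :* (con 1ℚ :- x))) refl

  telescope : (f t : ℕ → ℚ) → (∀ i → 0ℚ ≤ f i) → (∀ i → 0ℚ ≤ t i) →
              (∀ i → f i + t (suc i) ≤ t i) →
              (∀ ε → 0ℚ < ε → ∃ λ M → t M < ε) →
              Cauchy (λ N → ∑< N f)
  telescope f t f≥0 t≥0 step t→0 ε 0<ε with t→0 ε 0<ε
  ... | M , tM<ε = M , λ m n m≥ n≥ → ∣∣< (one m n m≥ n≥)
        (subst (_< ε) (sym (neg-diff (F m) (F n))) (one n m n≥ m≥))
    where
    F = λ N → ∑< N f
    lower : ∀ d → F M ≤ F (d ℕ.+ M)
    lower zero    = ≤-refl
    lower (suc d) = ≤-trans (lower d) (p≤p+q (f≥0 (d ℕ.+ M)))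
    upper : ∀ d → F (d ℕ.+ M) + t (d ℕ.+ M) ≤ F M + t M
    upper zero    = ≤-refl
    upper (suc d) = ≤-trans
      (subst (_≤ F (d ℕ.+ M) + t (d ℕ.+ M))
        (sym (+-assoc (F (d ℕ.+ M)) (f (d ℕ.+ M)) (t (suc d ℕ.+ M))))
        (+-monoʳ-≤ (F (d ℕ.+ M)) (step (d ℕ.+ M))))
      (upper d)
    one : ∀ m n → M ℕ.≤ m → M ℕ.≤ n → F m - F n < ε
    one m n m≥ n≥ = ≤-<-trans (diff≤ (begin
      F m                ≤⟨ p≤p+q (t≥0 m) ⟩
      F m + t m          ≤⟨ subst (λ k → F k + t k ≤ F M + t M) (ℕ.m∸n+n≡m m≥) (upper (m ℕ.∸ M)) ⟩
      F M + t M          ≡⟨ +-comm (F M) (t M) ⟩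
      t M + F M          ≤⟨ +-monoʳ-≤ (t M) (subst (λ k → F M ≤ F k) (ℕ.m∸n+n≡m n≥) (lower (n ℕ.∸ M))) ⟩
      t M + F n          ∎)) tM<ε
      where open ≤-Reasoning

  -- Every series dominated by ∑ H_n^k / n² converges.
  summable : ∀ k (f : ℕ → ℚ) → (∀ i → 0ℚ ≤ f i) →
             (∀ i → f i ≤ h (suc i) ^ℚ k * (recip i * recip i)) →
             Cauchy (λ N → ∑< N f)
  summable k f f≥0 f≤ = telescope f t f≥0
    (λ i → 0≤* D≥0 (0≤* (a≥0 (suc i)) (recip≥0 i))) step t→0
    where
    open ≤-Reasoning
    three = + 3 / 1
    D = three * κ k
    D>0 : 0ℚ < D
    D>0 = 0<* (positive⁻¹ three) (κ>0 k)
    D≥0 : 0ℚ ≤ D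
    D≥0 = <⇒≤ D>0
    t : ℕ → ℚ
    t i = D * (a (suc i) * recip i)
    step : ∀ i → f i + t (suc i) ≤ t i
    step i = begin
      f i + t (suc i)
        ≤⟨ +-monoˡ-≤ (t (suc i)) (≤-trans (f≤ i)
             (*-monoʳ (0≤* (recip≥0 i) (recip≥0 i)) (h^≤ k (suc i)))) ⟩
      K * A * (x * x) + three * K * ((A + ¼ * (y * A)) * y)
        ≤⟨ ≤-from-diff (K * A * (x * ((y + y) - x) + (y * (x - y) + ¼ * (y * y))))
             (0≤* (0≤* (κ≥0 k) (a≥0 (suc i)))
               (0≤+ (0≤* (recip≥0 i) (diff≥0 (recip≤2recip i)))
                 (0≤+ (0≤* (recip≥0 (suc i)) (diff≥0 (recip-anti i)))
                   (0≤* 0≤¼ (0≤* (recip≥0 (suc i)) (recip≥0 (suc i)))))))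
             (eq K A x y) ⟩
      three * K * (A * (y + x * y))
        ≡⟨ cong (λ z → three * K * (A * z)) (sym (recip-step i)) ⟩
      t i ∎
      where
      x = recip i
      y = recip (suc i)
      A = a (suc i)
      K = κ k
      eq : ∀ K A x y → three * K * (A * (y + x * y)) ≡
        (K * A * (x * x) + three * K * ((A + ¼ * (y * A)) * y)) +
        K * A * (x * ((y + y) - x) + (y * (x - y) + ¼ * (y * y)))
      eq = solve 4 (λ K A x y → con three :* K :* (A :* (y :+ x :* y)) :=
        (K :* A :* (x :* x) :+ con three :* K :* ((A :+ con ¼ :* (y :* A)) :* y)) :+
        K :* A :* (x :* ((y :+ y) :- x) :+ (y :* (x :- y) :+ con ¼ :* (y :* y)))) refl
    t²≤ : ∀ i → t i * t i ≤ D * D * (1ℚ + 1ℚ) * recip i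
    t²≤ i = begin
      D * (A * x) * (D * (A * x))          ≡⟨ eq₁ D A x ⟩
      D * D * ((A * A) * (x * x))          ≤⟨ *-monoˡ DD≥0 (*-monoʳ (0≤* (recip≥0 i) (recip≥0 i)) (a²≤ (suc i))) ⟩
      D * D * ((j + 1ℚ) * (x * x))         ≡⟨ eq₂ D j x ⟩
      D * D * ((x * j) * x + x * x)        ≡⟨ cong (λ z → D * D * (z * x + x * x)) (recip*ι i) ⟩
      D * D * (1ℚ * x + x * x)             ≤⟨ *-monoˡ DD≥0 (+-monoʳ-≤ (1ℚ * x) (*≤ (recip≥0 i) (recip≤1 i))) ⟩
      D * D * (1ℚ * x + x)                 ≡⟨ eq₃ D x ⟩
      D * D * (1ℚ + 1ℚ) * x                ∎
      where
      x = recip i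
      A = a (suc i)
      j = ι (suc i)
      DD≥0 = 0≤* D≥0 D≥0
      eq₁ : ∀ D A x → D * (A * x) * (D * (A * x)) ≡ D * D * ((A * A) * (x * x))
      eq₁ = solve 3 (λ D A x → D :* (A :* x) :* (D :* (A :* x)) :=
        D :* D :* ((A :* A) :* (x :* x))) refl
      eq₂ : ∀ D j x → D * D * ((j + 1ℚ) * (x * x)) ≡ D * D * ((x * j) * x + x * x)
      eq₂ = solve 3 (λ D j x → D :* D :* ((j :+ con 1ℚ) :* (x :* x)) :=
        D :* D :* ((x :* j) :* x :+ x :* x)) refl
      eq₃ : ∀ D x → D * D * (1ℚ * x + x) ≡ D * D * (1ℚ + 1ℚ) * x
      eq₃ = solve 2 (λ D x → D :* D :* (con 1ℚ :* x :+ x) :=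
        D :* D :* (con 1ℚ :+ con 1ℚ) :* x) refl
    t→0 : ∀ ε → 0ℚ < ε → ∃ λ M → t M < ε
    t→0 ε 0<ε = proj₁ small , ≰⇒> (λ ε≤t → <-irrefl refl (≤-<-trans
      (≤-trans (*-mono (≤-trans (<⇒≤ 0<ε) ε≤t) (<⇒≤ 0<ε) ε≤t ε≤t) (t²≤ (proj₁ small)))
      (proj₂ small)))
      where
      small : ∃ λ i → D * D * (1ℚ + 1ℚ) * recip i < ε * ε
      small = archimedean (0<* (0<* D>0 D>0) (positive⁻¹ (1ℚ + 1ℚ))) (0<* 0<ε 0<ε)

  ζ≤≥0 : ∀ N ss → 0ℚ ≤ ζ≤ N ss
  ζ≤≥0 N       []       = 0≤1
  ζ≤≥0 zero    (s ∷ ss) = ≤-refl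
  ζ≤≥0 (suc N) (s ∷ ss) =
    0≤+ (ζ≤≥0 N (s ∷ ss)) (0≤* (^≥0 s (recip≥0 N)) (ζ≤≥0 N ss))

  ζ≤≤h^ : ∀ N {ss} → All (0 ℕ.<_) ss → ζ≤ N ss ≤ h N ^ℚ length ss
  ζ≤≤h^ N       []                    = ≤-refl
  ζ≤≤h^ zero    {s ∷ ss} (0<s ∷ 0<ss) =
    ≤-reflexive (sym (*-zeroˡ (0ℚ ^ℚ length ss)))
  ζ≤≤h^ (suc N) {s ∷ ss} (0<s ∷ 0<ss) = begin
    ζ≤ N (s ∷ ss) + x ^ℚ s * ζ≤ N ss
      ≤⟨ +-mono-≤ (ζ≤≤h^ N (0<s ∷ 0<ss))
           (*-mono (recip≥0 N) (ζ≤≥0 N ss) (recip^≤recip N 0<s) (ζ≤≤h^ N 0<ss)) ⟩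
    h N * h N ^ℚ k + x * h N ^ℚ k
      ≡⟨ sym (*-distribʳ-+ (h N ^ℚ k) (h N) x) ⟩
    (h N + x) * h N ^ℚ k
      ≤⟨ *-monoˡ (h≥0 (suc N)) (^-mono k (h≥0 N) (p≤p+q (recip≥0 N))) ⟩
    (h N + x) * (h N + x) ^ℚ k ∎
    where
    open ≤-Reasoning
    x = recip N
    k = length ss

  ζ-cauchy : ∀ s → Admissible s → Cauchy (λ N → ζ≤ N s)
  ζ-cauchy (s ∷ ss) (1<s , 0<ss) = summable (length ss) _
    (λ i → 0≤* (^≥0 s (recip≥0 i)) (ζ≤≥0 i ss))
    (λ i → subst (recip i ^ℚ s * ζ≤ i ss ≤_)
      (*-comm (recip i * recip i) (h (suc i) ^ℚ length ss))
      (*-mono (0≤* (recip≥0 i) (recip≥0 i)) (ζ≤≥0 i ss) (recip^≤recip² i 1<s)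
        (≤-trans (ζ≤≤h^ i 0<ss)
          (^-mono (length ss) (h≥0 i) (p≤p+q (recip≥0 i))))))

  H≥0 : ∀ r n → 0ℚ ≤ H r n
  H≥0 r zero    = ≤-refl
  H≥0 r (suc n) = 0≤+ (H≥0 r n) (^≥0 r (recip≥0 n))

  H≤h : ∀ {r} n → 0 ℕ.< r → H r n ≤ h n
  H≤h zero    0<r = ≤-refl
  H≤h (suc n) 0<r = +-mono-≤ (H≤h n 0<r) (recip^≤recip n 0<r)

  S-cauchy : ∀ r m q → 0 ℕ.< r → 1 ℕ.< q → Cauchy (λ N → S≤ N r m q)
  S-cauchy r m q 0<r 1<q = summable m _
    (λ i → 0≤* (^≥0 m (H≥0 r (suc i))) (^≥0 q (recip≥0 i)))
    (λ i → *-mono (^≥0 m (h≥0 (suc i))) (^≥0 q (recip≥0 i))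
      (^-mono m (H≥0 r (suc i)) (H≤h (suc i) 0<r)) (recip^≤recip² i 1<q))

-- The infinite series, as limits of their partial sums.

ζ : (s : List ℕ) → Admissible s → ℝ
ζ s adm = mkℝ (λ N → ζ≤ N s) (ζ-cauchy s adm)

S : (r m q : ℕ) → 0 ℕ.< r → 1 ℕ.< q → ℝ
S r m q 0<r 1<q = mkℝ (λ N → S≤ N r m q) (S-cauchy r m q 0<r 1<q)

admissible : ∀ {r q l} → 1 ℕ.< r → 1 ℕ.< q → (η : Composition l) →
             Admissible (map (r ℕ.*_) (parts η) ++ [ q ])
admissible {r} {q} 1<r 1<q (composition [] _ _) = 1<q , []
admissible {r} {q} 1<r 1<q (composition (e ∷ es) (0<e ∷ 0<es) _) =
  ℕ.≤-trans 1<r (ℕ.m≤m*n r e {{ℕ.>-nonZero 0<e}}) ,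
  All.++⁺ (All.map⁺ (All.map (ℕ.*-mono-≤ (ℕ.<⇒≤ 1<r)) 0<es)) (ℕ.<⇒≤ 1<q ∷ [])

{-# OPTIONS --safe #-}
module Submission where

-- The identity already holds between the N-th partial sums. For n ≤ N put
-- T_n = H_N − H_n, the sum of k^(-r) over n < k ≤ N; the binomial theorem expands
-- H_n^m = (H_N − T_n)^m in powers of T_n. It remains to see that
-- P_l(N) = ∑_{n ≤ N} T_n^l n^(-q) is the sum over η ∈ C_l of the multinomial
-- coefficient times the truncated multiple zeta value. Both sides
-- vanish at N = 0 and satisfy, for l ≥ 1,
--   P_l(N+1) = P_l(N) + ∑_{1 ≤ e ≤ l} binom(l,e) (N+1)^(-re) P_{l-e}(N):
-- the first by the binomial theorem for (T_n + (N+1)^(-r))^l, the second by splitting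
-- off the terms with n₁ = N + 1 and sorting the compositions by their first part e.

open import Algebra.Bundles using (CommutativeRing)
open import Algebra.Definitions.RawSemiring using (_×_)
open import Data.Fin.Base using (Fin; zero; suc; toℕ)
open import Data.Fin.Properties using (toℕ≤pred[n])
open import Data.Integer.Base using (+_)
import Data.Integer.Base as ℤ
import Data.Integer.Properties as ℤ
open import Data.List.Base using (List; _∷_; []; _++_; foldr; map; upTo; applyUpTo)
open import Data.List.Properties using (map-∘; map-upTo)
open import Data.List.Relation.Unary.All using ([])
import Data.List.Relation.Unary.All as All
import Data.List.Relation.Unary.All.Properties as All
open import Data.Nat.Base using (ℕ; zero; suc; _*_; _∸_; _≤_; s≤s; _!; NonZero)
import Data.Nat.Base as ℕ
open import Data.Nat.Combinatorics using (_C_; nCk≡n!/k![n-k]!; k![n∸k]!∣n!)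
open import Data.Nat.DivMod using (m/n*n≡m)
open import Data.Nat.ListAction using (product)
open import Data.Nat.ListAction.Properties using (product≢0)
import Data.Nat.Properties as ℕ
open import Data.Nat.Properties using (<⇒≤)
open import Data.Nat.Tactic.RingSolver using (solve-∀)
open import Data.Product.Base using (_,_)
open import Data.Rational.Base using (ℚ; +-*-rawSemiring; 0ℚ; 1ℚ; _/_; toℚᵘ; -_; ∣_∣; _<_)
  renaming (_+_ to _+ℚ_; _*_ to _*ℚ_; _-_ to _-ℚ_)
open import Data.Rational.Properties
  using (+-*-commutativeRing; +-identityˡ; +-identityʳ; +-assoc; +-inverseʳ
        ; *-zeroˡ; *-zeroʳ; *-identityˡ; *-identityʳ; *-comm; *-distribˡ-+; *-distribʳ-+
        ; toℚᵘ-injective; toℚᵘ-fromℚᵘ; toℚᵘ-homo-*; toℚᵘ-homo-+; fromℚᵘ-cong)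
open import Data.Rational.Solver using (module +-*-Solver)
import Data.Rational.Unnormalised.Base as ℚᵘ
import Data.Rational.Unnormalised.Properties as ℚᵘ
open import Function.Base using (_∘_)
open import Relation.Binary.PropositionalEquality
  using (_≡_; refl; sym; trans; cong; cong₂; subst; module ≡-Reasoning)
open import Defs

open CommutativeRing +-*-commutativeRing using (semiring; commutativeSemiring)
open import Algebra.Properties.CommutativeSemiring.Binomial commutativeSemiring
  using () renaming (theorem to binomial-theorem)
open import Algebra.Properties.CommutativeSemiring.Exp commutativeSemiring
  using (^-distrib-*; ^-assocʳ)
open import Algebra.Properties.Semiring.Sum semiring
  using (sum; sum-cong-≗; ∑-distrib-+; *-distribˡ-sum; *-distribʳ-sum)
open +-*-Solver using (solve; _:=_; _:+_; _:*_; _:-_; con)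
open ≡-Reasoning

private variable
  A B : Set

-- Finite sums

-- The rational shadow of `∑`: the same fold over the same list, so that a term of the sequence of a
-- real sum is a `sumOver`.
sumOver : List A → (A → ℚ) → ℚ
sumOver xs f = foldr _+ℚ_ 0ℚ (map f xs)

sumOver-cong : ∀ (xs : List A) {f g : A → ℚ} → (∀ x → f x ≡ g x) → sumOver xs f ≡ sumOver xs g
sumOver-cong []       f≗g = refl
sumOver-cong (x ∷ xs) f≗g = cong₂ _+ℚ_ (f≗g x) (sumOver-cong xs f≗g)

sumOver-map : ∀ (h : A → B) (f : B → ℚ) xs → sumOver (map h xs) f ≡ sumOver xs (f ∘ h)
sumOver-map h f xs = cong (foldr _+ℚ_ 0ℚ) (sym (map-∘ xs))

sumOver-++ : ∀ (f : A → ℚ) xs ys → sumOver (xs ++ ys) f ≡ sumOver xs f +ℚ sumOver ys f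
sumOver-++ f []       ys = sym (+-identityˡ _)
sumOver-++ f (x ∷ xs) ys = trans (cong (f x +ℚ_) (sumOver-++ f xs ys)) (sym (+-assoc (f x) _ _))

+-interchange : ∀ a b c d → (a +ℚ b) +ℚ (c +ℚ d) ≡ (a +ℚ c) +ℚ (b +ℚ d)
+-interchange = solve 4 (λ a b c d → (a :+ b) :+ (c :+ d) := (a :+ c) :+ (b :+ d)) refl

sumOver-distrib-+ : ∀ (f g : A → ℚ) xs →
  sumOver xs (λ x → f x +ℚ g x) ≡ sumOver xs f +ℚ sumOver xs g
sumOver-distrib-+ f g []       = refl
sumOver-distrib-+ f g (x ∷ xs) = trans (cong (f x +ℚ g x +ℚ_) (sumOver-distrib-+ f g xs))
  (+-interchange (f x) (g x) _ _)

*-distribˡ-sumOver : ∀ c (f : A → ℚ) xs → c *ℚ sumOver xs f ≡ sumOver xs (λ x → c *ℚ f x)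
*-distribˡ-sumOver c f []       = *-zeroʳ c
*-distribˡ-sumOver c f (x ∷ xs) = trans (*-distribˡ-+ c (f x) _)
  (cong (c *ℚ f x +ℚ_) (*-distribˡ-sumOver c f xs))

-- Bridges the theorem, whose outer sum runs over a list, and the binomial theorem of the library,
-- whose sum runs over `Fin`.
sumOver-upTo : ∀ n (f : ℕ → ℚ) → sumOver (upTo n) f ≡ sum {n} (f ∘ toℕ)
sumOver-upTo n f = trans (cong (foldr _+ℚ_ 0ℚ) (map-upTo f n)) (go n f)
  where
  go : ∀ n f → foldr _+ℚ_ 0ℚ (applyUpTo f n) ≡ sum {n} (f ∘ toℕ)
  go zero    f = refl
  go (suc n) f = cong (f 0 +ℚ_) (go n (f ∘ suc))

∑<-cong : ∀ N {f g : ℕ → ℚ} → (∀ i → f i ≡ g i) → ∑< N f ≡ ∑< N g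
∑<-cong zero    f≗g = refl
∑<-cong (suc N) f≗g = cong₂ _+ℚ_ (∑<-cong N f≗g) (f≗g N)

∑<-distrib-+ : ∀ N (f g : ℕ → ℚ) → ∑< N (λ i → f i +ℚ g i) ≡ ∑< N f +ℚ ∑< N g
∑<-distrib-+ zero    f g = refl
∑<-distrib-+ (suc N) f g = trans (cong (_+ℚ (f N +ℚ g N)) (∑<-distrib-+ N f g))
  (+-interchange (∑< N f) (∑< N g) (f N) (g N))

*-distribˡ-∑< : ∀ N c (f : ℕ → ℚ) → c *ℚ ∑< N f ≡ ∑< N (λ i → c *ℚ f i)
*-distribˡ-∑< zero    c f = *-zeroʳ c
*-distribˡ-∑< (suc N) c f = trans (*-distribˡ-+ c _ (f N))
  (cong (_+ℚ c *ℚ f N) (*-distribˡ-∑< N c f))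

∑<-zero : ∀ N → ∑< N (λ _ → 0ℚ) ≡ 0ℚ
∑<-zero zero    = refl
∑<-zero (suc N) = trans (+-identityʳ _) (∑<-zero N)

∑<-sum-comm : ∀ N {n} (f : ℕ → Fin n → ℚ) →
  ∑< N (λ i → sum (f i)) ≡ sum (λ k → ∑< N (λ i → f i k))
∑<-sum-comm N {zero}  f = ∑<-zero N
∑<-sum-comm N {suc n} f = trans (∑<-distrib-+ N (λ i → f i zero) _)
  (cong (∑< N (λ i → f i zero) +ℚ_) (∑<-sum-comm N (λ i → f i ∘ suc)))

-- Fractions and multinomial coefficients

-- `_/_` reduces to lowest terms and so hides numerator and denominator. The comparison is made on
-- unnormalised fractions, where multiplication acts on each of them separately.
/-* : ∀ a b c d .{{_ : NonZero b}} .{{_ : NonZero d}} .{{_ : NonZero (b * d)}} →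
  (+ a / b) *ℚ (+ c / d) ≡ + (a * c) / (b * d)
/-* a b@(suc _) c d@(suc _) = toℚᵘ-injective (ℚᵘ.≃-trans (toℚᵘ-homo-* (+ a / b) (+ c / d))
  (ℚᵘ.≃-trans (ℚᵘ.*-cong (toℚᵘ-fromℚᵘ (ℚᵘ.mkℚᵘ (+ a) _)) (toℚᵘ-fromℚᵘ (ℚᵘ.mkℚᵘ (+ c) _)))
  (ℚᵘ.≃-trans (ℚᵘ.*≡* (cong (ℤ._* (+ (b * d))) (sym (ℤ.pos-* a c))))
  (ℚᵘ.≃-sym (toℚᵘ-fromℚᵘ (ℚᵘ.mkℚᵘ (+ (a * c)) _))))))

/-cross : ∀ a b c d .{{_ : NonZero b}} .{{_ : NonZero d}} → a * d ≡ c * b → + a / b ≡ + c / d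
/-cross a b@(suc _) c d@(suc _) eq = fromℚᵘ-cong {ℚᵘ.mkℚᵘ (+ a) _} {ℚᵘ.mkℚᵘ (+ c) _}
  (ℚᵘ.*≡* (trans (sym (ℤ.pos-* a d)) (trans (cong +_ eq) (ℤ.pos-* c b))))

/1-suc : ∀ n → + suc n / 1 ≡ 1ℚ +ℚ (+ n / 1)
/1-suc n = toℚᵘ-injective (ℚᵘ.≃-trans (toℚᵘ-fromℚᵘ (ℚᵘ.mkℚᵘ (+ suc n) 0))
  (ℚᵘ.≃-trans (ℚᵘ.*≡* (cong (λ z → (+ 1 ℤ.+ z) ℤ.* + 1) (sym (ℤ.*-identityʳ (+ n)))))
  (ℚᵘ.≃-sym (ℚᵘ.≃-trans (toℚᵘ-homo-+ 1ℚ (+ n / 1))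
    (ℚᵘ.+-congʳ (toℚᵘ 1ℚ) (toℚᵘ-fromℚᵘ (ℚᵘ.mkℚᵘ (+ n) 0)))))))

-- The library's binomial theorem writes its coefficients as repeated addition; here they become
-- rational factors that can be regrouped.
×≡* : ∀ n p → _×_ +-*-rawSemiring n p ≡ (+ n / 1) *ℚ p
×≡* zero    p = sym (*-zeroˡ p)
×≡* (suc n) p = begin
  p +ℚ _×_ +-*-rawSemiring n p      ≡⟨ cong₂ _+ℚ_ (sym (*-identityˡ p)) (×≡* n p) ⟩
  1ℚ *ℚ p +ℚ (+ n / 1) *ℚ p         ≡⟨ *-distribʳ-+ p 1ℚ (+ n / 1) ⟨
  (1ℚ +ℚ (+ n / 1)) *ℚ p            ≡⟨ cong (_*ℚ p) (/1-suc n) ⟨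
  (+ suc n / 1) *ℚ p                ∎

nCk*k![n-k]!≡n! : ∀ {n k} → k ≤ n → (n C k) * (k ! * (n ∸ k) !) ≡ n !
nCk*k![n-k]!≡n! {n} {k} k≤n = trans
  (cong (_* (k ! * (n ∸ k) !)) (nCk≡n!/k![n-k]! k≤n))
  (m/n*n≡m {{k ℕ.!* (n ∸ k) !≢0}} (k![n∸k]!∣n! k≤n))

-- Substituting n! = binom(n,k) k! (n-k)! into the defining fraction separates the factor k! of the
-- first part from the factorials of `es`.
multinomial-∷ : ∀ {n k} es → k ≤ n →
  multinomial n (k ∷ es) ≡ (+ (n C k) / 1) *ℚ multinomial (n ∸ k) es
multinomial-∷ {n} {k} es k≤n = trans
  (/-cross (n !) (k ! * P) ((n C k) * (n ∸ k) !) (1 * P) cross)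
  (sym (/-* (n C k) 1 ((n ∸ k) !) P))
  where
  P = product (map _! es)
  instance
    P≢0 : NonZero P
    P≢0 = product≢0 (All.map⁺ (All.universal ℕ._!≢0 es))
    1P≢0 : NonZero (1 * P)
    1P≢0 = ℕ.m*n≢0 1 P
    kP≢0 : NonZero (k ! * P)
    kP≢0 = ℕ.m*n≢0 (k !) P {{k ℕ.!≢0}}
  rearrange : ∀ c a b p → c * (a * b) * (1 * p) ≡ c * b * (a * p)
  rearrange = solve-∀
  cross : n ! * (1 * P) ≡ (n C k) * (n ∸ k) ! * (k ! * P)
  cross = trans (cong (_* (1 * P)) (sym (nCk*k![n-k]!≡n! k≤n)))
    (rearrange (n C k) (k !) ((n ∸ k) !) P)

binomial-expansion : ∀ n x y → (x +ℚ y) ^ℚ n ≡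
  sum {suc n} (λ k → (+ (n C toℕ k) / 1) *ℚ (x ^ℚ toℕ k *ℚ y ^ℚ (n ∸ toℕ k)))
binomial-expansion n x y = trans (binomial-theorem n x y)
  (sum-cong-≗ {suc n} (λ k → ×≡* (n C toℕ k) (x ^ℚ toℕ k *ℚ y ^ℚ (n ∸ toℕ k))))

-- Compositions, sorted by their first part

-- Induction on `l` along the recursion of `compositionsFrom`: either the first part is k + 1, or
-- its lower bound rises by one. As `f` sees only the list of parts, `recast` leaves no trace.
sumOver-compositionsFrom : ∀ k l (f : List ℕ → ℚ) →
  sumOver (compositionsFrom k l) (f ∘ parts) ≡
  sum {suc l} (λ e → sumOver (compositions (l ∸ toℕ e)) (λ η → f (suc (k ℕ.+ toℕ e) ∷ parts η)))
sumOver-compositionsFrom k zero f =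
  trans (cong (λ j → f (suc j ∷ []) +ℚ 0ℚ) (sym (ℕ.+-identityʳ k))) (sym (+-identityʳ _))
sumOver-compositionsFrom k (suc l) f = begin
  sumOver (map (cons k) (compositionsFrom 0 l) ++ map rc (compositionsFrom (suc k) l)) (f ∘ parts)
    ≡⟨ sumOver-++ (f ∘ parts) (map (cons k) (compositionsFrom 0 l)) _ ⟩
  sumOver (map (cons k) (compositionsFrom 0 l)) (f ∘ parts) +ℚ
  sumOver (map rc (compositionsFrom (suc k) l)) (f ∘ parts)
    ≡⟨ cong₂ _+ℚ_ (sumOver-map (cons k) (f ∘ parts) (compositionsFrom 0 l))
         (sumOver-map rc (f ∘ parts) (compositionsFrom (suc k) l)) ⟩
  sumOver (compositionsFrom 0 l) (λ η → f (suc k ∷ parts η)) +ℚ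
  sumOver (compositionsFrom (suc k) l) (f ∘ parts)
    -- The left summand is e = 0: its tails are `compositions (suc l)`, which unfolds to
    -- `compositionsFrom 0 l`. The right one covers e + 1, with the bound shifted from k to k + 1.
    ≡⟨ cong₂ _+ℚ_
         (cong (λ j → sumOver (compositionsFrom 0 l) (λ η → f (suc j ∷ parts η))) (sym (ℕ.+-identityʳ k)))
         (trans (sumOver-compositionsFrom (suc k) l f)
           (sum-cong-≗ {suc l} (λ e → cong
             (λ j → sumOver (compositions (l ∸ toℕ e)) (λ η → f (suc j ∷ parts η)))
             (sym (ℕ.+-suc k (toℕ e)))))) ⟩
  sum {suc (suc l)} (λ e → sumOver (compositions (suc l ∸ toℕ e))
    (λ η → f (suc (k ℕ.+ toℕ e) ∷ parts η))) ∎
  where rc = recast (sym (ℕ.+-suc (suc k) l))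

-- Truncated series

ζ≤-[] : ∀ r N → ζ≤ N (r ∷ []) ≡ H r N
ζ≤-[] r N = ∑<-cong N (λ i → *-identityʳ (recip i ^ℚ r))

-- The trailing `q` keeps the list nonempty and hence the sum over n₁ empty; on `[]` itself the
-- value would be 1.
ζ≤-empty : ∀ ss q → ζ≤ 0 (ss ++ q ∷ []) ≡ 0ℚ
ζ≤-empty []       q = refl
ζ≤-empty (s ∷ ss) q = refl

module _ (r q : ℕ) where

  weighted : ℕ → ℕ → List ℕ → ℚ
  weighted N l es = multinomial l es *ℚ ζ≤ N (map (r *_) es ++ q ∷ [])

  -- P_l(N) as first defined: for n = i + 1 the base of the power is T_n.
  tailPowers : ℕ → ℕ → ℚ
  tailPowers N l = ∑[ i < N ] ((H r N -ℚ H r (suc i)) ^ℚ l *ℚ recip i ^ℚ q)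

  -- The factor of the recurrence for P_(l+1), where `e` stands for the part e + 1 and `recip N` is
  -- 1/(N+1).
  coefficient : ℕ → ℕ → ℕ → ℚ
  coefficient N l e = (+ (suc l C suc e) / 1) *ℚ (recip N ^ℚ r) ^ℚ suc e

  -- `ζ≤` unfolds at `suc N` into the terms with n₁ ≤ N and those with n₁ = N + 1, whose other
  -- indices are at most N. In the latter `multinomial-∷` splits the weight between first part and
  -- tail.
  weighted-suc : ∀ N l e es → e ≤ l → weighted (suc N) (suc l) (suc e ∷ es) ≡
    weighted N (suc l) (suc e ∷ es) +ℚ coefficient N l e *ℚ weighted N (l ∸ e) es
  weighted-suc N l e es e≤l = begin
    M *ℚ (ζ≤ N (map (r *_) (suc e ∷ es) ++ q ∷ []) +ℚ recip N ^ℚ (r * suc e) *ℚ Z)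
      ≡⟨ *-distribˡ-+ M _ _ ⟩
    weighted N (suc l) (suc e ∷ es) +ℚ M *ℚ (recip N ^ℚ (r * suc e) *ℚ Z)
      ≡⟨ cong (weighted N (suc l) (suc e ∷ es) +ℚ_) (begin
        M *ℚ (recip N ^ℚ (r * suc e) *ℚ Z)
          ≡⟨ cong₂ (λ m x → m *ℚ (x *ℚ Z)) (multinomial-∷ es (s≤s e≤l))
               (sym (^-assocʳ (recip N) r (suc e))) ⟩
        c *ℚ m *ℚ (x *ℚ Z)
          ≡⟨ solve 4 (λ c m x z → c :* m :* (x :* z) := c :* x :* (m :* z)) refl c m x Z ⟩
        c *ℚ x *ℚ (m *ℚ Z) ∎) ⟩
    weighted N (suc l) (suc e ∷ es) +ℚ coefficient N l e *ℚ weighted N (l ∸ e) es ∎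
    where
    M = multinomial (suc l) (suc e ∷ es)
    Z = ζ≤ N (map (r *_) es ++ q ∷ [])
    c = + (suc l C suc e) / 1
    m = multinomial (l ∸ e) es
    x = (recip N ^ℚ r) ^ℚ suc e

  compositionSum : ℕ → ℕ → ℚ
  compositionSum N l = sumOver (compositions l) (weighted N l ∘ parts)

  compositionSum-suc : ∀ N l → compositionSum (suc N) (suc l) ≡
    compositionSum N (suc l) +ℚ
    sum {suc l} (λ e → coefficient N l (toℕ e) *ℚ compositionSum N (l ∸ toℕ e))
  compositionSum-suc N l = begin
    compositionSum (suc N) (suc l)
      ≡⟨ sumOver-compositionsFrom 0 l (weighted (suc N) (suc l)) ⟩
    sum {suc l} (λ e → sumOver (compositions (l ∸ toℕ e))
      (λ η → weighted (suc N) (suc l) (suc (toℕ e) ∷ parts η)))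
      ≡⟨ sum-cong-≗ {suc l} byFirstPart ⟩
    sum {suc l} (λ e → old e +ℚ new e)
      ≡⟨ ∑-distrib-+ {suc l} old new ⟩
    sum old +ℚ sum new
      -- Sorting by first part is undone for the terms with n₁ ≤ N.
      ≡⟨ cong (_+ℚ sum new) (sumOver-compositionsFrom 0 l (weighted N (suc l))) ⟨
    compositionSum N (suc l) +ℚ sum new ∎
    where
    old new : Fin (suc l) → ℚ
    old e = sumOver (compositions (l ∸ toℕ e)) (λ η → weighted N (suc l) (suc (toℕ e) ∷ parts η))
    new e = coefficient N l (toℕ e) *ℚ compositionSum N (l ∸ toℕ e)
    byFirstPart : ∀ e → sumOver (compositions (l ∸ toℕ e))
      (λ η → weighted (suc N) (suc l) (suc (toℕ e) ∷ parts η)) ≡ old e +ℚ new e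
    byFirstPart e = begin
      sumOver ηs (λ η → weighted (suc N) (suc l) (suc (toℕ e) ∷ parts η))
        ≡⟨ sumOver-cong ηs (λ η → weighted-suc N l (toℕ e) (parts η) (toℕ≤pred[n] e)) ⟩
      sumOver ηs (λ η → weighted N (suc l) (suc (toℕ e) ∷ parts η) +ℚ
                        c *ℚ weighted N (l ∸ toℕ e) (parts η))
        ≡⟨ sumOver-distrib-+ _ _ ηs ⟩
      old e +ℚ sumOver ηs (λ η → c *ℚ weighted N (l ∸ toℕ e) (parts η))
        ≡⟨ cong (old e +ℚ_) (*-distribˡ-sumOver c _ ηs) ⟨
      old e +ℚ new e ∎
      where
      ηs = compositions (l ∸ toℕ e)
      c = coefficient N l (toℕ e)

  -- Passing from N to N + 1 adds x = (N+1)^(-r) to every T_n with n ≤ N. The power of x + T_n is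
  -- expanded, and its term free of x gives back P_(l+1)(N).
  tailPowers-suc : ∀ N l → tailPowers (suc N) (suc l) ≡
    tailPowers N (suc l) +ℚ
    sum {suc l} (λ e → coefficient N l (toℕ e) *ℚ tailPowers N (l ∸ toℕ e))
  tailPowers-suc N l = begin
    (∑[ i < N ] ((H r N +ℚ x -ℚ H r (suc i)) ^ℚ suc l *ℚ g i)) +ℚ
    (H r (suc N) -ℚ H r (suc N)) ^ℚ suc l *ℚ g N
      -- The new index n = N + 1 contributes nothing: its tail is empty and the exponent l + 1 is
      -- positive.
      ≡⟨ cong₂ _+ℚ_ (∑<-cong N expand) (trans
           (cong (λ z → z ^ℚ suc l *ℚ g N) (+-inverseʳ (H r (suc N))))
           (trans (cong (_*ℚ g N) (*-zeroˡ (0ℚ ^ℚ l))) (*-zeroˡ (g N)))) ⟩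
    (∑[ i < N ] (T i ^ℚ suc l *ℚ g i +ℚ
      sum {suc l} (λ e → c e *ℚ (T i ^ℚ (l ∸ toℕ e) *ℚ g i)))) +ℚ 0ℚ
      ≡⟨ +-identityʳ _ ⟩
    ∑[ i < N ] (T i ^ℚ suc l *ℚ g i +ℚ
      sum {suc l} (λ e → c e *ℚ (T i ^ℚ (l ∸ toℕ e) *ℚ g i)))
      ≡⟨ ∑<-distrib-+ N (λ i → T i ^ℚ suc l *ℚ g i) _ ⟩
    tailPowers N (suc l) +ℚ
    (∑[ i < N ] sum {suc l} (λ e → c e *ℚ (T i ^ℚ (l ∸ toℕ e) *ℚ g i)))
      ≡⟨ cong (tailPowers N (suc l) +ℚ_) (trans
           (∑<-sum-comm N (λ i e → c e *ℚ (T i ^ℚ (l ∸ toℕ e) *ℚ g i)))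
           (sum-cong-≗ {suc l} (λ e → sym (*-distribˡ-∑< N (c e) (λ i → T i ^ℚ (l ∸ toℕ e) *ℚ g i))))) ⟩
    tailPowers N (suc l) +ℚ sum {suc l} (λ e → c e *ℚ tailPowers N (l ∸ toℕ e)) ∎
    where
    x = recip N ^ℚ r
    g : ℕ → ℚ
    g i = recip i ^ℚ q
    T : ℕ → ℚ
    T i = H r N -ℚ H r (suc i)
    c : Fin (suc l) → ℚ
    c e = coefficient N l (toℕ e)
    first : ∀ t g → 1ℚ *ℚ (1ℚ *ℚ t) *ℚ g ≡ t *ℚ g
    first = solve 2 (λ t g → con 1ℚ :* (con 1ℚ :* t) :* g := t :* g) refl
    rest : ∀ b y t g → b *ℚ (y *ℚ t) *ℚ g ≡ b *ℚ y *ℚ (t *ℚ g)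
    rest = solve 4 (λ b y t g → b :* (y :* t) :* g := b :* y :* (t :* g)) refl
    expand : ∀ i → (H r N +ℚ x -ℚ H r (suc i)) ^ℚ suc l *ℚ g i ≡
      T i ^ℚ suc l *ℚ g i +ℚ sum {suc l} (λ e → c e *ℚ (T i ^ℚ (l ∸ toℕ e) *ℚ g i))
    expand i = begin
      (H r N +ℚ x -ℚ H r (suc i)) ^ℚ suc l *ℚ g i
        ≡⟨ cong (λ z → z ^ℚ suc l *ℚ g i)
             (solve 3 (λ h x k → h :+ x :- k := x :+ (h :- k)) refl (H r N) x (H r (suc i))) ⟩
      (x +ℚ T i) ^ℚ suc l *ℚ g i
        ≡⟨ cong (_*ℚ g i) (binomial-expansion (suc l) x (T i)) ⟩
      sum {suc (suc l)} term *ℚ g i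
        ≡⟨ *-distribʳ-sum (g i) term ⟩
      sum {suc (suc l)} (λ k → term k *ℚ g i)
        -- The term k = 0 is split off, with binomial coefficient and power of x both 1; k = e + 1
        -- gives the others.
        ≡⟨ cong₂ _+ℚ_ (first (T i ^ℚ suc l) (g i))
             (sum-cong-≗ {suc l} (λ e → rest (+ (suc l C suc (toℕ e)) / 1)
               (x ^ℚ suc (toℕ e)) (T i ^ℚ (l ∸ toℕ e)) (g i))) ⟩
      T i ^ℚ suc l *ℚ g i +ℚ sum {suc l} (λ e → c e *ℚ (T i ^ℚ (l ∸ toℕ e) *ℚ g i)) ∎
      where
      term : Fin (suc (suc l)) → ℚ
      term k = (+ (suc l C toℕ k) / 1) *ℚ (x ^ℚ toℕ k *ℚ T i ^ℚ (suc l ∸ toℕ k))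

  -- Induction on N for all exponents at once, since the shared recurrence reaches every smaller
  -- exponent. It covers only positive exponents; at exponent 0 both sides are the partial sum of
  -- ζ(q).
  tailPowers≡compositionSum : ∀ N l → tailPowers N l ≡ compositionSum N l
  tailPowers≡compositionSum N zero =
    trans (∑<-cong N (λ i → *-comm 1ℚ (recip i ^ℚ q)))
      (sym (trans (+-identityʳ _) (*-identityˡ _)))
  tailPowers≡compositionSum zero (suc l) = sym (trans
    -- Each vanishing summand is written as `0ℚ *ℚ 0ℚ`, so that a factor 0 can be pulled out of the
    -- whole sum.
    (sumOver-cong ηs (λ η → trans
      (cong (multinomial (suc l) (parts η) *ℚ_) (ζ≤-empty (map (r *_) (parts η)) q))
      (trans (*-zeroʳ (multinomial (suc l) (parts η))) (sym (*-zeroˡ 0ℚ)))))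
    (trans (sym (*-distribˡ-sumOver 0ℚ (λ _ → 0ℚ) ηs)) (*-zeroˡ (sumOver ηs (λ _ → 0ℚ)))))
    where ηs = compositions (suc l)
  tailPowers≡compositionSum (suc N) (suc l) = begin
    tailPowers (suc N) (suc l)
      ≡⟨ tailPowers-suc N l ⟩
    tailPowers N (suc l) +ℚ
    sum {suc l} (λ e → coefficient N l (toℕ e) *ℚ tailPowers N (l ∸ toℕ e))
      ≡⟨ cong₂ _+ℚ_ (tailPowers≡compositionSum N (suc l))
           (sum-cong-≗ {suc l} (λ e → cong (coefficient N l (toℕ e) *ℚ_)
             (tailPowers≡compositionSum N (l ∸ toℕ e)))) ⟩
    compositionSum N (suc l) +ℚ
    sum {suc l} (λ e → coefficient N l (toℕ e) *ℚ compositionSum N (l ∸ toℕ e))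
      ≡⟨ compositionSum-suc N l ⟨
    compositionSum (suc N) (suc l) ∎

  S≤-expansion : ∀ N m → S≤ N r m q ≡
    sumOver (upTo (suc m)) (λ l → sumOver (compositions l) (λ η →
      (- 1ℚ) ^ℚ l *ℚ (+ (m C l) / 1) *ℚ multinomial l (parts η) *ℚ
      ζ≤ N (r ∷ []) ^ℚ (m ∸ l) *ℚ ζ≤ N (map (r *_) (parts η) ++ q ∷ [])))
  S≤-expansion N m = begin
    ∑[ i < N ] (H r (suc i) ^ℚ m *ℚ g i)
      ≡⟨ ∑<-cong N expand ⟩
    ∑[ i < N ] sum {suc m} (λ k → c (toℕ k) *ℚ (T i ^ℚ toℕ k *ℚ g i))
      ≡⟨ ∑<-sum-comm N {suc m} (λ i k → c (toℕ k) *ℚ (T i ^ℚ toℕ k *ℚ g i)) ⟩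
    sum {suc m} (λ k → ∑[ i < N ] (c (toℕ k) *ℚ (T i ^ℚ toℕ k *ℚ g i)))
      -- From here on the index is a natural number l rather than an element of `Fin`, as in the
      -- theorem.
      ≡⟨ sumOver-upTo (suc m) (λ l → ∑[ i < N ] (c l *ℚ (T i ^ℚ l *ℚ g i))) ⟨
    sumOver (upTo (suc m)) (λ l → ∑[ i < N ] (c l *ℚ (T i ^ℚ l *ℚ g i)))
      ≡⟨ sumOver-cong (upTo (suc m)) collect ⟩
    sumOver (upTo (suc m)) (λ l → sumOver (compositions l) (λ η →
      (- 1ℚ) ^ℚ l *ℚ (+ (m C l) / 1) *ℚ multinomial l (parts η) *ℚ
      ζ≤ N (r ∷ []) ^ℚ (m ∸ l) *ℚ ζ≤ N (map (r *_) (parts η) ++ q ∷ []))) ∎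
    where
    Z = ζ≤ N (r ∷ [])
    g : ℕ → ℚ
    g i = recip i ^ℚ q
    T : ℕ → ℚ
    T i = H r N -ℚ H r (suc i)
    c : ℕ → ℚ
    c l = (- 1ℚ) ^ℚ l *ℚ (+ (m C l) / 1) *ℚ Z ^ℚ (m ∸ l)

    -- The tail stands first because `binomial-expansion` puts the exponent k on its first argument;
    -- the explicit factor -1 then yields the sign (-1)^l through `^-distrib-*`.
    H≡Z-T : ∀ i → H r (suc i) ≡ (- 1ℚ) *ℚ T i +ℚ Z
    H≡Z-T i = trans
      (solve 2 (λ h z → h := con (- 1ℚ) :* (z :- h) :+ z) refl (H r (suc i)) (H r N))
      (cong ((- 1ℚ) *ℚ T i +ℚ_) (sym (ζ≤-[] r N)))

    expand : ∀ i → H r (suc i) ^ℚ m *ℚ g i ≡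
      sum {suc m} (λ k → c (toℕ k) *ℚ (T i ^ℚ toℕ k *ℚ g i))
    expand i = begin
      H r (suc i) ^ℚ m *ℚ g i
        ≡⟨ cong (λ z → z ^ℚ m *ℚ g i) (H≡Z-T i) ⟩
      ((- 1ℚ) *ℚ T i +ℚ Z) ^ℚ m *ℚ g i
        ≡⟨ cong (_*ℚ g i) (binomial-expansion m ((- 1ℚ) *ℚ T i) Z) ⟩
      sum {suc m} term *ℚ g i
        ≡⟨ *-distribʳ-sum (g i) term ⟩
      sum {suc m} (λ k → term k *ℚ g i)
        ≡⟨ sum-cong-≗ {suc m} (λ k → let l = toℕ k in trans
             (cong (λ y → (+ (m C l) / 1) *ℚ (y *ℚ Z ^ℚ (m ∸ l)) *ℚ g i) (^-distrib-* (- 1ℚ) (T i) l))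
             (solve 5 (λ b s t z g → b :* (s :* t :* z) :* g := s :* b :* z :* (t :* g)) refl
               (+ (m C l) / 1) ((- 1ℚ) ^ℚ l) (T i ^ℚ l) (Z ^ℚ (m ∸ l)) (g i))) ⟩
      sum {suc m} (λ k → c (toℕ k) *ℚ (T i ^ℚ toℕ k *ℚ g i)) ∎
      where
      term : Fin (suc m) → ℚ
      term k = (+ (m C toℕ k) / 1) *ℚ (((- 1ℚ) *ℚ T i) ^ℚ toℕ k *ℚ Z ^ℚ (m ∸ toℕ k))

    collect : ∀ l → ∑[ i < N ] (c l *ℚ (T i ^ℚ l *ℚ g i)) ≡
      sumOver (compositions l) (λ η →
        (- 1ℚ) ^ℚ l *ℚ (+ (m C l) / 1) *ℚ multinomial l (parts η) *ℚ
        Z ^ℚ (m ∸ l) *ℚ ζ≤ N (map (r *_) (parts η) ++ q ∷ []))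
    collect l = begin
      ∑[ i < N ] (c l *ℚ (T i ^ℚ l *ℚ g i))
        -- `c l` contains H_N but not n, so it leaves the sum over n, and P_l(N) remains.
        ≡⟨ *-distribˡ-∑< N (c l) _ ⟨
      c l *ℚ tailPowers N l
        ≡⟨ cong (c l *ℚ_) (tailPowers≡compositionSum N l) ⟩
      c l *ℚ compositionSum N l
        ≡⟨ *-distribˡ-sumOver (c l) _ (compositions l) ⟩
      sumOver (compositions l) (λ η → c l *ℚ weighted N l (parts η))
        ≡⟨ sumOver-cong (compositions l) (λ η →
             solve 5 (λ s b z m ζ → s :* b :* z :* (m :* ζ) := s :* b :* m :* z :* ζ) refl
               ((- 1ℚ) ^ℚ l) (+ (m C l) / 1) (Z ^ℚ (m ∸ l)) (multinomial l (parts η))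
               (ζ≤ N (map (r *_) (parts η) ++ q ∷ []))) ⟩
      sumOver (compositions l) (λ η →
        (- 1ℚ) ^ℚ l *ℚ (+ (m C l) / 1) *ℚ multinomial l (parts η) *ℚ
        Z ^ℚ (m ∸ l) *ℚ ζ≤ N (map (r *_) (parts η) ++ q ∷ [])) ∎

-- From partial sums to real numbers

seq-∑ : ∀ (xs : List A) (f : A → ℝ) {g : A → ℚ} n →
  (∀ x → seq (f x) n ≡ g x) → seq (∑ xs f) n ≡ sumOver xs g
seq-∑ []       f n f≗g = refl
seq-∑ (x ∷ xs) f n f≗g = cong₂ _+ℚ_ (f≗g x) (seq-∑ xs f n f≗g)

-- Sums and products of reals are termwise by definition; a power with a variable exponent is so
-- only by induction.
seq-^ : ∀ x k n → seq (x ^ℝ k) n ≡ seq x n ^ℚ k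
seq-^ x zero    n = refl
seq-^ x (suc k) n = cong (seq x n *ℚ_) (seq-^ x k n)

-- Every difference is 0, so the threshold 0 serves for each ε and no estimate of convergence
-- enters.
pointwise⇒≃ℝ : ∀ x y → (∀ n → seq x n ≡ seq y n) → x ≃ℝ y
pointwise⇒≃ℝ x y x≗y ε 0<ε = 0 , λ n _ →
  subst (λ z → ∣ z ∣ < ε) (sym (trans (cong (_-ℚ seq y n) (x≗y n)) (+-inverseʳ (seq y n)))) 0<ε

theorem3p6 : (m r q : ℕ) → 1 ≤ m → (2≤r : 2 ≤ r) → (2≤q : 2 ≤ q) →
    S r m q (<⇒≤ 2≤r) 2≤q ≃ℝ
    (∑[ l ∈ upTo (suc m) ] ∑[ η ∈ compositions l ]
    (-ℝ 1ℝ) ^ℝ l *ℝ fromℕ (m C l) *ℝ fromℚ (multinomial l (parts η)) *ℝ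
    ζ (r ∷ []) (2≤r , []) ^ℝ (m ∸ l) *ℝ
    ζ (map (r *_) (parts η) ++ q ∷ []) (admissible 2≤r 2≤q η))
theorem3p6 m r q _ 2≤r 2≤q = pointwise⇒≃ℝ
  (S r m q (<⇒≤ 2≤r) 2≤q) (∑ (upTo (suc m)) λ l → ∑ (compositions l) (term l)) λ N →
  trans (S≤-expansion r q N m) (sym
  (seq-∑ (upTo (suc m)) (λ l → ∑ (compositions l) (term l)) N λ l →
    -- At index N all factors reduce to their rational forms except the two powers, (-1)^l and
    -- ζ(r)^(m-l).
    seq-∑ (compositions l) (term l) N λ η → cong₂
      (λ s z → s *ℚ (+ (m C l) / 1) *ℚ multinomial l (parts η) *ℚ z *ℚ
               ζ≤ N (map (r *_) (parts η) ++ q ∷ []))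
      (seq-^ (-ℝ 1ℝ) l N) (seq-^ (ζ (r ∷ []) (2≤r , [])) (m ∸ l) N)))
  where
  term : ∀ l → Composition l → ℝ
  term l η =
    (-ℝ 1ℝ) ^ℝ l *ℝ fromℕ (m C l) *ℝ fromℚ (multinomial l (parts η)) *ℝ
    ζ (r ∷ []) (2≤r , []) ^ℝ (m ∸ l) *ℝ
    ζ (map (r *_) (parts η) ++ q ∷ []) (admissible 2≤r 2≤q η)
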